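{- Let $\mathbb{O}(P)$ be the limit of order ideals associated with an inverse system $\langle\{P_n\},\{p^n_k\}_{k<n}\rangle$ of nonempty finite posets with quotient maps. Then $\mathbb{O}(P)$ is $\sigma$-complete: every countable subset of $\mathbb{O}(P)$ has a supremum and an infimum in $\mathbb{O}(P)$.
   Context: A quotient map between posets is a surjective order-preserving map $\phi:A\to B$ such that for all $a\le b$ in $B$ there are $x\le y$ in $A$ with $\phi(x)=a,\phi(y)=b$. The inverse system: nonempty finite posets $P_n$, quotient maps $p^m_k:P_m\to P_k$ ($k<m$) with $p^k_l\circ p^m_k=p^m_l$. $\mathcal{O}(P_n)$ is the set of down-sets of $P_n$ under inclusion; for a quotient map $p:Q\to R$ of finite posets, $\hat p(\emptyset)=\emptyset$ and $\hat p(A)=\bigcup_i\downarrow p(a_i)$ over the maximal elements $a_i$ of $A$, where $\downarrow x=\{m:m\le x\}$. $\mathbb{O}(P):=\{(A_n)\in\prod_n\mathcal{O}(P_n):\widehat{p^{n+1}_n}(A_{n+1})=A_n\ \forall n\}$, ordered coordinatewise by inclusion. -}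

module Defs where

open import Data.Fin.Base using (Fin)
open import Data.Nat.Base using (ℕ; suc; _<_)
open import Data.Nat.Properties using (<-trans; n<1+n)
open import Data.Product.Base using (∃; ∃-syntax; _×_; _,_; proj₁; proj₂)
open import Function.Base using (id; _∘_; flip)
open import Function.Bundles using (Injection; Inverse)
open import Function.Definitions using (Surjective)
open import Level using (Level; _⊔_) renaming (suc to lsuc)
open import Relation.Binary.Bundles using (Poset; Setoid)
open import Relation.Binary.Definitions using (_Respects_)
open import Relation.Binary.Morphism.Bundles using (PosetHomomorphism)
import Relation.Binary.Construct.On as On
import Relation.Binary.PropositionalEquality.Properties as ≡
open import Relation.Unary using (Pred; _∈_; _⊆_; _≐_)

Finite : ∀ {c ℓ} → Setoid c ℓ → Set (c ⊔ ℓ)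
Finite S = ∃[ n ] Inverse (≡.setoid (Fin n)) S

module _ {c ℓ₁ ℓ₂ : Level} where

  record QuotientMap (A B : Poset c ℓ₁ ℓ₂) : Set (c ⊔ ℓ₁ ⊔ ℓ₂) where
    private
      module A = Poset A
      module B = Poset B
    field
      homomorphism : PosetHomomorphism A B
    open PosetHomomorphism homomorphism public using (⟦_⟧; mono; cong)
    field
      surjective : Surjective A._≈_ B._≈_ ⟦_⟧
      lift-≤     : ∀ {a b} → a B.≤ b →
                   ∃[ x ] ∃[ y ] x A.≤ y × ⟦ x ⟧ B.≈ a × ⟦ y ⟧ B.≈ b

  record InverseSystem : Set (lsuc (c ⊔ ℓ₁ ⊔ ℓ₂)) where
    field
      P        : ℕ → Poset c ℓ₁ ℓ₂
      finite   : ∀ n → Finite (Poset.Eq.setoid (P n))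
      nonempty : ∀ n → Poset.Carrier (P n)
      p        : ∀ {k m} → k < m → QuotientMap (P m) (P k)
    open module p {k m} (k<m : k < m) = QuotientMap (p k<m) public using (⟦_⟧)
    field
      p-∘ : ∀ {l k m} (l<k : l < k) (k<m : k < m) x →
            Poset._≈_ (P l) (⟦ l<k ⟧ (⟦ k<m ⟧ x)) (⟦ <-trans l<k k<m ⟧ x)

  -- Membership takes values in the universe Set (c ⊔ ℓ₁ ⊔ ℓ₂) so that the
  -- map hat below stays within the same type of down-sets.
  record DownSet (A : Poset c ℓ₁ ℓ₂) : Set (lsuc (c ⊔ ℓ₁ ⊔ ℓ₂)) where
    open Poset A using (Carrier; _≤_)
    field
      members    : Pred Carrier (c ⊔ ℓ₁ ⊔ ℓ₂)
      downClosed : members Respects flip _≤_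

  open DownSet public

  IsMaximalIn : (A : Poset c ℓ₁ ℓ₂) → DownSet A → Pred (Poset.Carrier A) (c ⊔ ℓ₁ ⊔ ℓ₂)
  IsMaximalIn A D a = a ∈ members D × (∀ b → b ∈ members D → a ≤ b → a ≈ b)
    where open Poset A using (_≤_; _≈_)

  -- The union of the principal down-sets ↓ p(a), a maximal in D.  For D = ∅
  -- the union is over no elements, so hat p ∅ = ∅ needs no separate clause.
  hat : {Q R : Poset c ℓ₁ ℓ₂} → QuotientMap Q R → DownSet Q → DownSet R
  hat {Q} {R} p D = record
    { members    = λ m → ∃[ a ] IsMaximalIn Q D a × m R.≤ ⟦ a ⟧
    ; downClosed = λ { y≤x (a , a-max , x≤pa) → a , a-max , R.trans y≤x x≤pa }
    }
    where
    module R = Poset R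
    open QuotientMap p using (⟦_⟧)

  record Thread (𝒫 : InverseSystem) : Set (lsuc (c ⊔ ℓ₁ ⊔ ℓ₂)) where
    open InverseSystem 𝒫 using (P; p)
    field
      at         : ∀ n → DownSet (P n)
      compatible : ∀ n → members (hat (p (n<1+n n)) (at (suc n))) ≐ members (at n)

  open Thread public

  𝕆 : InverseSystem → Poset (lsuc (c ⊔ ℓ₁ ⊔ ℓ₂)) (c ⊔ ℓ₁ ⊔ ℓ₂) (c ⊔ ℓ₁ ⊔ ℓ₂)
  𝕆 𝒫 = record
    { Carrier = Thread 𝒫
    ; _≈_     = λ A B → ∀ n → members (at A n) ≐ members (at B n)
    ; _≤_     = λ A B → ∀ n → members (at A n) ⊆ members (at B n)
    ; isPartialOrder = record
      { isPreorder = record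
        { isEquivalence = record
          { refl  = λ n → id , id
          ; sym   = λ A≈B n → proj₂ (A≈B n) , proj₁ (A≈B n)
          ; trans = λ A≈B B≈C n → proj₁ (B≈C n) ∘ proj₁ (A≈B n)
                                , proj₂ (A≈B n) ∘ proj₂ (B≈C n)
          }
        ; reflexive = λ A≈B n → proj₁ (A≈B n)
        ; trans     = λ A≤B B≤C n → B≤C n ∘ A≤B n
        }
      ; antisym = λ A≤B B≤A n → A≤B n , B≤A n
      }
    }

module _ {c ℓ₁ ℓ₂ s : Level} (L : Poset c ℓ₁ ℓ₂) where
  open Poset L using (Carrier; _≤_; module Eq)

  -- The elements of S, compared by the equality of L, inject into ℕ; finite
  -- and empty S are included.
  Countable : Pred Carrier s → Set (c ⊔ ℓ₁ ⊔ s)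
  Countable S = Injection (On.setoid Eq.setoid (proj₁ {B = S})) (≡.setoid ℕ)

  IsSupremum IsInfimum : Pred Carrier s → Pred Carrier (c ⊔ ℓ₂ ⊔ s)
  IsSupremum S u = (∀ x → x ∈ S → x ≤ u) × (∀ v → (∀ x → x ∈ S → x ≤ v) → u ≤ v)
  IsInfimum  S u = (∀ x → x ∈ S → u ≤ x) × (∀ v → (∀ x → x ∈ S → v ≤ x) → v ≤ u)

σ-Complete : ∀ {c ℓ₁ ℓ₂} (s : Level) → Poset c ℓ₁ ℓ₂ → Set (c ⊔ ℓ₁ ⊔ ℓ₂ ⊔ lsuc s)
σ-Complete s L = (S : Pred (Poset.Carrier L) s) → Countable L S →
                 ∃ (IsSupremum L S) × ∃ (IsInfimum L S)

{-# OPTIONS --safe #-}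
-- For a finite poset every element of a down-set lies below a maximal one, so
-- hat p D is just the down-closure of the image p(D), and hence hat p commutes
-- with arbitrary unions.  Coordinatewise unions of threads are therefore
-- threads, which gives all suprema, and infima are the suprema of the sets of
-- lower bounds.
module Submission where

open import Defs
open import Axiom.ExcludedMiddle using (ExcludedMiddle)
open import Level using (_⊔_; suc)

open import Data.Fin.Base using (Fin)
open import Data.Fin.Induction using (po-noetherian)
open import Data.Nat.Base using (_+_)
open import Data.Nat.Properties using (n<1+n)
open import Data.Product.Base using (∃-syntax; _×_; _,_; proj₁; proj₂)
open import Function.Base using (flip)
open import Function.Bundles using (Inverse)
open import Induction.WellFounded using (Acc; acc)
open import Level using (Level; Lift; lift; lower)
open import Relation.Binary.Bundles using (Poset)
import Relation.Binary.Construct.On as On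
import Relation.Binary.Construct.NonStrictToStrict as ToStrict
open import Relation.Nullary using (yes; no)
open import Relation.Nullary.Decidable
  using (True; toWitness; fromWitness; map′; decidable-stable)
open import Relation.Unary using (Pred; _∈_; _⊆_)

em-lower : ∀ {a} b → ExcludedMiddle (a ⊔ b) → ExcludedMiddle a
em-lower b em {P} = map′ lower lift (em {Lift b P})

module _ {c ℓ₁ ℓ₂ : Level} (em : ExcludedMiddle (c ⊔ ℓ₁ ⊔ ℓ₂)) where

  -- Climb from `a` to strictly larger members of `D` until none is left. The order pulled back to
  -- the indices in `Fin n` is Noetherian, so the climb stops.
  maximal-above : (A : Poset c ℓ₁ ℓ₂) → Finite (Poset.Eq.setoid A) →
                  (D : DownSet A) → ∀ {a} → a ∈ members D →
                  ∃[ b ] IsMaximalIn A D b × Poset._≤_ A a b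
  maximal-above A (n , enum) D {a} a∈D =
    let i≈a = to∘from a
        b , b-max , i≤b = go (po-noetherian ⊑-isPartialOrder (from a))
                             -- `to (from a)` is only `≈ a`; down-closure along `reflexive` carries
                             -- membership across.
                             (downClosed D (A.reflexive i≈a) a∈D)
    in b , b-max , A.trans (A.reflexive (A.Eq.sym i≈a)) i≤b
    where
    module A = Poset A
    open Inverse enum using (to; from; strictlyInverseˡ)

    to∘from : ∀ x → to (from x) A.≈ x
    to∘from = strictlyInverseˡ

    ⊑-isPartialOrder = On.isPartialOrder to A.isPartialOrder

    _⊏_ : Fin n → Fin n → Set _
    _⊏_ = ToStrict._<_ (λ i j → to i A.≈ to j) (λ i j → to i A.≤ to j)

    go : ∀ {i} → Acc (flip _⊏_) i → to i ∈ members D →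
         ∃[ b ] IsMaximalIn A D b × to i A.≤ b
    go {i} (acc rec) i∈D
      with em {∃[ j ] to j ∈ members D × i ⊏ j}
    ... | yes (j , j∈D , i⊏j) =
      let b , b-max , j≤b = go (rec i⊏j) j∈D
      in b , b-max , A.trans (proj₁ i⊏j) j≤b
    ... | no ∄j = to i , (i∈D , i-max) , A.refl
      where
      i-max : ∀ b → b ∈ members D → to i A.≤ b → to i A.≈ b
      -- If `b` differed from `to i`, its index would be a member strictly above `i`, against `∄j`.
      i-max b b∈D i≤b = decidable-stable (em-lower (c ⊔ ℓ₂) em) λ i≉b →
        ∄j (from b , downClosed D (A.reflexive (to∘from b)) b∈D
           , A.trans i≤b (A.reflexive (A.Eq.sym (to∘from b)))
           , λ i≈j → i≉b (A.Eq.trans i≈j (to∘from b)))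

  -- A maximal `b` above `a` exists, and `p` is monotone, so any bound by the image of `a` is also
  -- one by the image of `b`.
  ∈-hat : {Q R : Poset c ℓ₁ ℓ₂} → Finite (Poset.Eq.setoid Q) →
          (p : QuotientMap Q R) (D : DownSet Q) → ∀ {a m} → a ∈ members D →
          Poset._≤_ R m (QuotientMap.⟦_⟧ p a) → m ∈ members (hat p D)
  ∈-hat {Q} {R} fin p D a∈D m≤pa =
    let b , b-max , a≤b = maximal-above Q fin D a∈D
    in b , b-max , Poset.trans R m≤pa (QuotientMap.mono p a≤b)

module _ {c ℓ₁ ℓ₂ : Level} (s : Level)
         (em : ExcludedMiddle (suc (c ⊔ ℓ₁ ⊔ ℓ₂) ⊔ s))
         (𝒫 : InverseSystem {c} {ℓ₁} {ℓ₂}) (S : Pred (Thread 𝒫) s) where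

  open InverseSystem 𝒫

  -- The union quantifies over threads and so lives in a universe too large for
  -- DownSet; excluded middle resizes it.
  ⋃ : ∀ n → DownSet (P n)
  ⋃ n = record
    { members    = λ m → Lift _ (True (em {∃[ A ] A ∈ S × m ∈ members (at A n)}))
    ; downClosed = λ y≤x (lift x∈⋃) →
        let A , A∈S , x∈A = toWitness x∈⋃
        in lift (fromWitness (A , A∈S , downClosed (at A n) y≤x x∈A))
    }

  ⋃-upper : ∀ {A} → A ∈ S → ∀ n → members (at A n) ⊆ members (⋃ n)
  ⋃-upper {A} A∈S n m∈A = lift (fromWitness (A , A∈S , m∈A))

  ⋃-elim : ∀ {n m} → m ∈ members (⋃ n) → ∃[ A ] A ∈ S × m ∈ members (at A n)
  ⋃-elim (lift m∈⋃) = toWitness m∈⋃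

  ⋃-thread : Thread 𝒫
  ⋃-thread = record { at = ⋃ ; compatible = λ n → hat⊆ n , ⊆hat n }
    where
    em′ : ExcludedMiddle (c ⊔ ℓ₁ ⊔ ℓ₂)
    em′ = em-lower (suc (c ⊔ ℓ₁ ⊔ ℓ₂) ⊔ s) em

    hat⊆ : ∀ n → members (hat (p (n<1+n n)) (⋃ (1 + n))) ⊆ members (⋃ n)
    hat⊆ n (a , (a∈⋃ , _) , m≤pa) =
      let A , A∈S , a∈A = ⋃-elim a∈⋃
      in ⋃-upper A∈S n (proj₁ (compatible A n)
           (∈-hat em′ (finite _) (p (n<1+n n)) (at A _) a∈A m≤pa))

    ⊆hat : ∀ n → members (⋃ n) ⊆ members (hat (p (n<1+n n)) (⋃ (1 + n)))
    -- `a` is maximal in one thread's down-set but perhaps not in the union; `∈-hat` passes to a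
    -- maximal element of the union above it.
    ⊆hat n m∈⋃ =
      let A , A∈S , m∈A         = ⋃-elim m∈⋃
          a , (a∈A , _) , m≤pa = proj₂ (compatible A n) m∈A
      in ∈-hat em′ (finite _) (p (n<1+n n)) (⋃ _) (⋃-upper A∈S _ a∈A) m≤pa

  ⋃-isSupremum : IsSupremum (𝕆 𝒫) S ⋃-thread
  ⋃-isSupremum = (λ A A∈S → ⋃-upper A∈S) , λ B S≤B n m∈⋃ →
    let A , A∈S , m∈A = ⋃-elim m∈⋃ in S≤B A A∈S n m∈A

module _ {c ℓ₁ ℓ₂ s : Level} (L : Poset c ℓ₁ ℓ₂) where
  open Poset L using (Carrier; _≤_)

  LowerBounds : Pred Carrier s → Pred Carrier (c ⊔ ℓ₂ ⊔ s)
  LowerBounds S v = ∀ x → x ∈ S → v ≤ x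

  -- Each `x` in `S` bounds the lower bounds from above, so `u ≤ x` by leastness; that `u` bounds
  -- them from above says it is the greatest.
  supremum-lowerBounds⇒infimum : ∀ S u → IsSupremum L (LowerBounds S) u →
                                 IsInfimum L S u
  supremum-lowerBounds⇒infimum _ _ (upper , least) =
    (λ x x∈S → least x λ v v≤S → v≤S x x∈S) , upper

mainTheorem16 : ∀ {c ℓ₁ ℓ₂ s} → ExcludedMiddle (suc (c ⊔ ℓ₁ ⊔ ℓ₂) ⊔ s) →
    (𝒫 : InverseSystem {c} {ℓ₁} {ℓ₂}) → σ-Complete s (𝕆 𝒫)
mainTheorem16 {c} {ℓ₁} {ℓ₂} {s} em 𝒫 S _ =
    (⋃-thread s em 𝒫 S , ⋃-isSupremum s em 𝒫 S)
  , ( ⋃-thread s′ em 𝒫 S↓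
    , supremum-lowerBounds⇒infimum (𝕆 𝒫) S (⋃-thread s′ em 𝒫 S↓)
        (⋃-isSupremum s′ em 𝒫 S↓))
  where
  -- The lower bounds quantify over all threads, which raises their level to `s′`; joining
  -- `suc (c ⊔ ℓ₁ ⊔ ℓ₂)` again changes nothing, so the same `em` applies.
  s′ = suc (c ⊔ ℓ₁ ⊔ ℓ₂) ⊔ s
  S↓ = LowerBounds (𝕆 𝒫) S
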